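{- Let $k\ge 2$ be an integer and let $0<\mu<\frac{1}{2(k+1)}$. For every sufficiently large $n$ divisible by $k+1$, there exists an $\left(n,\frac{k}{k+1}+\frac{\mu}{2},\mu\right)$-incompatibility system $(G,\mathcal{F})$ that contains no compatible $k$-th power of a Hamilton cycle.
   Context: All graphs are finite and simple. An incompatibility system $\mathcal{F}$ over a graph $G=(V,E)$ is a family $\mathcal{F}=\{F_v\}_{v\in V}$ such that for every $v\in V$, $F_v$ is a family of unordered pairs $\{e,e'\}$ of distinct edges of $G$ with $e\cap e'=\{v\}$. Two edges $e,e'$ are incompatible (at $v$) if $\{e,e'\}\in F_v$ for some vertex $v$; otherwise they are compatible. A (not necessarily induced) subgraph $H\subseteq G$ is compatible if every pair of adjacent edges of $H$ is compatible. For $\Delta>0$, $\mathcal{F}$ is $\Delta$-bounded if for every vertex $v$ and every edge $e$ incident with $v$, there are at most $\Delta$ other edges incident with $v$ that are incompatible with $e$ at $v$. Given $\mu,\delta>0$ and $n\in\mathbb{N}$, an $(n,\delta,\mu)$-incompatibility system $(G,\mathcal{F})$ consists of an $n$-vertex graph $G$ with minimum degree $\delta(G)\ge\delta n$ and a $\mu n$-bounded incompatibility system $\mathcal{F}$ over $G$. The $k$-th power of a Hamilton cycle is the graph on the same vertex set whose edges join all pairs of distinct vertices at distance at most $k$ in the Hamilton cycle (where the cycle is a cyclic ordering of all $n$ vertices, and all these edges are required to be edges of $G$). -}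

module Defs where

open import Data.Fin.Base as Fin using (Fin; toℕ)
import Data.Fin.Properties as Fin
open import Data.Fin.Permutation using (Permutation′; _⟨$⟩ˡ_)
open import Data.Integer.Base using (+_)
open import Data.List.Base using (length; filter; allFin)
open import Data.Nat.Base as ℕ using (ℕ; zero; suc)
import Data.Nat.Properties as ℕ
open import Data.Product using (Σ; ∃-syntax; _×_; _,_; proj₁; proj₂)
open import Data.Rational.Base as ℚ using (ℚ; 0ℚ; 1ℚ; ½; _/_; 1/_)
import Data.Rational.Properties as ℚ
open import Data.Sum.Base using (_⊎_; swap)
open import Function.Base using (_∘_)
open import Level using (0ℓ)
open import Relation.Binary.Core using (Rel)
open import Relation.Binary.Definitions using (Decidable; Symmetric)
open import Relation.Binary.PropositionalEquality
open import Relation.Nullary using (¬_)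
open import Relation.Nullary.Decidable using (_×-dec_; _⊎-dec_; ¬?; map′)
open import Relation.Unary as Unary using (Pred)

------------------------------------------------------------------------
-- Real numbers, as Cauchy sequences of rationals.  Equality of reals is
-- never needed; all comparisons below respect it.

record ℝ : Set where
  field
    approx : ℕ → ℚ
    cauchy : ∀ ε → 0ℚ ℚ.< ε → ∃[ N ] ∀ i j → N ℕ.≤ i → N ℕ.≤ j →
             ℚ.∣ approx i ℚ.- approx j ∣ ℚ.≤ ε

open ℝ

infix  4 _≤ᴿ_ _<ᴿ_
infixl 6 _+ᴿ_
infixl 7 _·_

_≤ᴿ_ : Rel ℝ 0ℓ
x ≤ᴿ y = ∀ ε → 0ℚ ℚ.< ε → ∃[ N ] ∀ i → N ℕ.≤ i →
         approx x i ℚ.≤ approx y i ℚ.+ ε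

_<ᴿ_ : Rel ℝ 0ℓ
x <ᴿ y = ∃[ ε ] 0ℚ ℚ.< ε × (∃[ N ] ∀ i → N ℕ.≤ i →
         approx x i ℚ.+ ε ℚ.≤ approx y i)

fromℚ : ℚ → ℝ
fromℚ q .approx _ = q
fromℚ q .cauchy ε 0<ε = 0 , λ _ _ _ _ →
  subst (ℚ._≤ ε) (sym (cong ℚ.∣_∣ (ℚ.+-inverseʳ q))) (ℚ.<⇒≤ 0<ε)

ℕ→ℚ : ℕ → ℚ
ℕ→ℚ m = + m / 1

fromℕ : ℕ → ℝ
fromℕ m = fromℚ (ℕ→ℚ m)

_+ᴿ_ : ℝ → ℝ → ℝ
(x +ᴿ y) .approx i = approx x i ℚ.+ approx y i
(x +ᴿ y) .cauchy ε 0<ε = Nx ℕ.⊔ Ny , bound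
  where
  ε/2 : ℚ
  ε/2 = ½ ℚ.* ε

  0<ε/2 : 0ℚ ℚ.< ε/2
  0<ε/2 = subst (ℚ._< ε/2) (ℚ.*-zeroʳ ½) (ℚ.*-monoʳ-<-pos ½ 0<ε)

  ε/2+ε/2 : ε/2 ℚ.+ ε/2 ≡ ε
  ε/2+ε/2 = trans (sym (ℚ.*-distribʳ-+ ε ½ ½)) (ℚ.*-identityˡ ε)

  Nx Ny : ℕ
  Nx = proj₁ (cauchy x ε/2 0<ε/2)
  Ny = proj₁ (cauchy y ε/2 0<ε/2)

  rearrange : ∀ a b c d →
    (a ℚ.- c) ℚ.+ (b ℚ.- d) ≡ (a ℚ.+ b) ℚ.- (c ℚ.+ d)
  rearrange a b c d = begin
    (a ℚ.- c) ℚ.+ (b ℚ.- d)         ≡⟨ ℚ.+-assoc a (ℚ.- c) (b ℚ.- d) ⟩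
    a ℚ.+ (ℚ.- c ℚ.+ (b ℚ.- d))     ≡⟨ cong (a ℚ.+_) (ℚ.+-assoc (ℚ.- c) b (ℚ.- d)) ⟨
    a ℚ.+ ((ℚ.- c ℚ.+ b) ℚ.- d)     ≡⟨ cong (λ t → a ℚ.+ (t ℚ.- d)) (ℚ.+-comm (ℚ.- c) b) ⟩
    a ℚ.+ ((b ℚ.- c) ℚ.- d)         ≡⟨ cong (a ℚ.+_) (ℚ.+-assoc b (ℚ.- c) (ℚ.- d)) ⟩
    a ℚ.+ (b ℚ.+ (ℚ.- c ℚ.- d))     ≡⟨ ℚ.+-assoc a b (ℚ.- c ℚ.- d) ⟨
    (a ℚ.+ b) ℚ.+ (ℚ.- c ℚ.- d)     ≡⟨ cong ((a ℚ.+ b) ℚ.+_) (ℚ.neg-distrib-+ c d) ⟨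
    (a ℚ.+ b) ℚ.- (c ℚ.+ d)         ∎
    where open ≡-Reasoning

  bound : ∀ i j → Nx ℕ.⊔ Ny ℕ.≤ i → Nx ℕ.⊔ Ny ℕ.≤ j →
    ℚ.∣ (approx x i ℚ.+ approx y i) ℚ.- (approx x j ℚ.+ approx y j) ∣ ℚ.≤ ε
  bound i j N≤i N≤j = begin
    ℚ.∣ (approx x i ℚ.+ approx y i) ℚ.- (approx x j ℚ.+ approx y j) ∣
      ≡⟨ cong ℚ.∣_∣ (rearrange (approx x i) (approx y i) (approx x j) (approx y j)) ⟨
    ℚ.∣ (approx x i ℚ.- approx x j) ℚ.+ (approx y i ℚ.- approx y j) ∣
      ≤⟨ ℚ.∣p+q∣≤∣p∣+∣q∣ (approx x i ℚ.- approx x j) (approx y i ℚ.- approx y j) ⟩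
    ℚ.∣ approx x i ℚ.- approx x j ∣ ℚ.+ ℚ.∣ approx y i ℚ.- approx y j ∣
      ≤⟨ ℚ.+-mono-≤
           (proj₂ (cauchy x ε/2 0<ε/2) i j (ℕ.m⊔n≤o⇒m≤o Nx Ny N≤i) (ℕ.m⊔n≤o⇒m≤o Nx Ny N≤j))
           (proj₂ (cauchy y ε/2 0<ε/2) i j (ℕ.m⊔n≤o⇒n≤o Nx Ny N≤i) (ℕ.m⊔n≤o⇒n≤o Nx Ny N≤j)) ⟩
    ε/2 ℚ.+ ε/2
      ≡⟨ ε/2+ε/2 ⟩
    ε ∎
    where open ℚ.≤-Reasoning

-- Multiplication of a real by a rational scalar.
_·_ : ℚ → ℝ → ℝ
(c · x) .approx i = c ℚ.* approx x i
(c · x) .cauchy ε 0<ε = proj₁ (cauchy x ε′ 0<ε′) , bound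
  where
  d : ℚ
  d = ℚ.∣ c ∣ ℚ.+ 1ℚ

  instance
    ∣c∣-nonNeg : ℚ.NonNegative ℚ.∣ c ∣
    ∣c∣-nonNeg = ℚ.∣-∣-nonNeg c

    d-pos : ℚ.Positive d
    d-pos = ℚ.nonNeg+pos⇒pos ℚ.∣ c ∣ 1ℚ

    d-nonZero : ℚ.NonZero d
    d-nonZero = ℚ.pos⇒nonZero d

    1/d-pos : ℚ.Positive (1/ d)
    1/d-pos = ℚ.1/pos⇒pos d

  ε′ : ℚ
  ε′ = 1/ d ℚ.* ε

  0<ε′ : 0ℚ ℚ.< ε′
  0<ε′ = subst (ℚ._< ε′) (ℚ.*-zeroʳ (1/ d)) (ℚ.*-monoʳ-<-pos (1/ d) 0<ε)

  instance
    ε′-nonNeg : ℚ.NonNegative ε′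
    ε′-nonNeg = ℚ.nonNegative (ℚ.<⇒≤ 0<ε′)

  ∣c∣≤d : ℚ.∣ c ∣ ℚ.≤ d
  ∣c∣≤d = subst (ℚ._≤ d) (ℚ.+-identityʳ ℚ.∣ c ∣)
    (ℚ.+-monoʳ-≤ ℚ.∣ c ∣ (ℚ.nonNegative⁻¹ 1ℚ))

  factor : ∀ a b → c ℚ.* (a ℚ.- b) ≡ c ℚ.* a ℚ.- c ℚ.* b
  factor a b = trans (ℚ.*-distribˡ-+ c a (ℚ.- b))
    (cong (c ℚ.* a ℚ.+_) (sym (ℚ.neg-distribʳ-* c b)))

  bound : ∀ i j → proj₁ (cauchy x ε′ 0<ε′) ℕ.≤ i → proj₁ (cauchy x ε′ 0<ε′) ℕ.≤ j →
    ℚ.∣ c ℚ.* approx x i ℚ.- c ℚ.* approx x j ∣ ℚ.≤ ε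
  bound i j N≤i N≤j = begin
    ℚ.∣ c ℚ.* approx x i ℚ.- c ℚ.* approx x j ∣
      ≡⟨ cong ℚ.∣_∣ (factor (approx x i) (approx x j)) ⟨
    ℚ.∣ c ℚ.* (approx x i ℚ.- approx x j) ∣
      ≡⟨ ℚ.∣p*q∣≡∣p∣*∣q∣ c (approx x i ℚ.- approx x j) ⟩
    ℚ.∣ c ∣ ℚ.* ℚ.∣ approx x i ℚ.- approx x j ∣
      ≤⟨ ℚ.*-monoˡ-≤-nonNeg ℚ.∣ c ∣ (proj₂ (cauchy x ε′ 0<ε′) i j N≤i N≤j) ⟩
    ℚ.∣ c ∣ ℚ.* ε′
      ≤⟨ ℚ.*-monoʳ-≤-nonNeg ε′ ∣c∣≤d ⟩
    d ℚ.* ε′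
      ≡⟨ ℚ.*-assoc d (1/ d) ε ⟨
    (d ℚ.* 1/ d) ℚ.* ε
      ≡⟨ cong (ℚ._* ε) (ℚ.*-inverseʳ d) ⟩
    1ℚ ℚ.* ε
      ≡⟨ ℚ.*-identityˡ ε ⟩
    ε ∎
    where open ℚ.≤-Reasoning

------------------------------------------------------------------------
-- Finite simple graphs on the vertex set Fin n

count : ∀ {n} {P : Pred (Fin n) 0ℓ} → Unary.Decidable P → ℕ
count {n} P? = length (filter P? (allFin n))

record Graph (n : ℕ) : Set₁ where
  field
    Adj    : Rel (Fin n) 0ℓ
    adj?   : Decidable Adj
    symm   : Symmetric Adj
    irrefl : ∀ {v} → ¬ Adj v v

open Graph

degree : ∀ {n} → Graph n → Fin n → ℕ
degree G v = count (adj? G v)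

-- Only edge sets matter for compatibility, so subgraphs are taken on
-- the whole vertex set.
_⊆ᴳ_ : ∀ {n} → Graph n → Graph n → Set
H ⊆ᴳ G = ∀ {u v} → Adj H u v → Adj G u v

data Walk {n} (G : Graph n) : ℕ → Rel (Fin n) 0ℓ where
  []  : ∀ {u} → Walk G 0 u u
  _∷_ : ∀ {ℓ u v w} → Adj G u v → Walk G ℓ v w → Walk G (suc ℓ) u w

-- The graph distance of u and v is at most k.
DistanceAtMost : ∀ {n} → Graph n → ℕ → Rel (Fin n) 0ℓ
DistanceAtMost G k u v = ∃[ ℓ ] ℓ ℕ.≤ k × Walk G ℓ u v

walk? : ∀ {n} (G : Graph n) ℓ → Decidable (Walk G ℓ)
walk? G zero u v = map′ (λ { refl → [] }) (λ { [] → refl }) (u Fin.≟ v)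
walk? G (suc ℓ) u w = map′
  (λ { (_ , e , p) → e ∷ p }) (λ { (e ∷ p) → _ , e , p })
  (Fin.any? λ v → adj? G u v ×-dec walk? G ℓ v w)

distanceAtMost? : ∀ {n} (G : Graph n) k → Decidable (DistanceAtMost G k)
distanceAtMost? G k u v = map′
  (λ { (i , p) → toℕ i , ℕ.s≤s⁻¹ (Fin.toℕ<n i) , p })
  (λ { (ℓ , ℓ≤k , p) → Fin.fromℕ< (ℕ.s≤s ℓ≤k) ,
         subst (λ m → Walk G m u v) (sym (Fin.toℕ-fromℕ< (ℕ.s≤s ℓ≤k))) p })
  (Fin.any? {n = suc k} λ i → walk? G (toℕ i) u v)

walk-snoc : ∀ {n} (G : Graph n) {ℓ u v w} →
            Walk G ℓ u v → Adj G v w → Walk G (suc ℓ) u w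
walk-snoc G []      f = f ∷ []
walk-snoc G (e ∷ p) f = e ∷ walk-snoc G p f

walk-sym : ∀ {n} (G : Graph n) {ℓ u v} → Walk G ℓ u v → Walk G ℓ v u
walk-sym G []      = []
walk-sym G (e ∷ p) = walk-snoc G (walk-sym G p) (symm G e)

power : ∀ {n} → ℕ → Graph n → Graph n
power k G .Adj u v = u ≢ v × DistanceAtMost G k u v
power k G .adj? u v = ¬? (u Fin.≟ v) ×-dec distanceAtMost? G k u v
power k G .symm (u≢v , ℓ , ℓ≤k , p) = u≢v ∘ sym , ℓ , ℓ≤k , walk-sym G p
power k G .irrefl (v≢v , _) = v≢v refl

-- j follows i in the cyclic order 0, 1, …, n-1, 0.
Next : ∀ {n} → Rel (Fin n) 0ℓ
Next {n} i j = toℕ j ≡ suc (toℕ i) ⊎ (suc (toℕ i) ≡ n × toℕ j ≡ 0)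

next? : ∀ {n} → Decidable (Next {n})
next? {n} i j = (toℕ j ℕ.≟ suc (toℕ i)) ⊎-dec
                ((suc (toℕ i) ℕ.≟ n) ×-dec (toℕ j ℕ.≟ 0))

-- The cyclic ordering of all n vertices in which v has position σ ⟨$⟩ˡ v,
-- as a graph.  This is a cycle for n ≥ 3; the condition u ≢ v only
-- excludes a loop when n = 1.
hamiltonCycle : ∀ {n} → Permutation′ n → Graph n
hamiltonCycle σ .Adj u v = u ≢ v ×
  (Next (σ ⟨$⟩ˡ u) (σ ⟨$⟩ˡ v) ⊎ Next (σ ⟨$⟩ˡ v) (σ ⟨$⟩ˡ u))
hamiltonCycle σ .adj? u v = ¬? (u Fin.≟ v) ×-dec
  (next? (σ ⟨$⟩ˡ u) (σ ⟨$⟩ˡ v) ⊎-dec next? (σ ⟨$⟩ˡ v) (σ ⟨$⟩ˡ u))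
hamiltonCycle σ .symm (u≢v , p) = u≢v ∘ sym , swap p
hamiltonCycle σ .irrefl (v≢v , _) = v≢v refl

------------------------------------------------------------------------
-- Incompatibility systems

-- Two distinct edges meeting in v are vu and vw with u ≢ w, so the
-- family F_v of unordered pairs {vu, vw} is encoded by the symmetric
-- relation Incompatible v on the other endpoints u and w.
record IncompatibilitySystem {n} (G : Graph n) : Set₁ where
  field
    Incompatible  : Fin n → Rel (Fin n) 0ℓ
    incompatible? : ∀ v → Decidable (Incompatible v)
    symmetric     : ∀ v → Symmetric (Incompatible v)
    distinct      : ∀ {v u w} → Incompatible v u w → u ≢ w
    edges         : ∀ {v u w} → Incompatible v u w → Adj G v u × Adj G v w

open IncompatibilitySystem

Bounded : ∀ {n} {G : Graph n} → ℝ → IncompatibilitySystem G → Set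
Bounded {G = G} Δ F =
  ∀ v u → Adj G v u → fromℕ (count (incompatible? F v u)) ≤ᴿ Δ

-- Adjacent edges of a simple graph share exactly one vertex v, so they
-- can only be incompatible at v.
Compatible : ∀ {n} {G : Graph n} → IncompatibilitySystem G → Graph n → Set
Compatible F H =
  ∀ {v u w} → Adj H v u → Adj H v w → u ≢ w → ¬ Incompatible F v u w

-- (n,δ,μ)-incompatibility systems
record BoundedIncompatibilitySystem (n : ℕ) (δ μ : ℝ) : Set₁ where
  field
    G         : Graph n
    F         : IncompatibilitySystem G
    minDegree : ∀ v → ℕ→ℚ n · δ ≤ᴿ fromℕ (degree G v)
    bounded   : Bounded (ℕ→ℚ n · μ) F

ContainsCompatibleHamiltonPower :
  ∀ {n} {G : Graph n} → ℕ → IncompatibilitySystem G → Set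
ContainsCompatibleHamiltonPower {n} {G} k F =
  Σ (Permutation′ n) λ σ →
    power k (hamiltonCycle σ) ⊆ᴳ G × Compatible F (power k (hamiltonCycle σ))

{-# OPTIONS --safe #-}

-- Write n = m(k+1).  Make a set A of m+1 vertices sparse, keeping all edges
-- not inside A, and declare two edges vu and vw incompatible whenever u and w
-- are adjacent vertices of A.  Inside A take a Cayley sum graph on ℤ/(m+1) of
-- degree about e, where μn/2 + 2 ≤ e ≤ μn: the lower bound gives the minimum
-- degree, and the upper bound the boundedness of the system.
--
-- In a k-th power of a Hamilton cycle k+1 consecutive vertices form a clique.
-- Cutting the cycle into m such blocks, some block contains two vertices u, w
-- of A; as k ≥ 2 it contains a third vertex v, and vu, vw are incompatible.

module Submission where

open import Defs
open import Data.Integer.Base using (+_)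
open import Data.Nat.Base using (ℕ; suc; _*_; _≤_)
open import Data.Nat.Divisibility using (_∣_)
open import Data.Product using (Σ; ∃-syntax)
open import Data.Rational.Base using (0ℚ; ½; _/_)
open import Relation.Nullary using (¬_)

open import Data.Fin.Base using (Fin; toℕ; fromℕ<; inject≤)
open import Data.Fin.Permutation using (Permutation′; _⟨$⟩ˡ_; _⟨$⟩ʳ_; inverseˡ; inverseʳ)
import Data.Fin.Properties as Fin
import Data.Integer.Base as ℤ
import Data.Integer.Properties as ℤ
open import Data.List.Base using (List; []; _∷_; length; filter; allFin; lookup)
import Data.List.Properties as List
open import Data.List.Membership.Propositional.Properties using (∈-filter⁻; ∈-lookup)
import Data.List.Relation.Unary.All as All
open import Data.List.Relation.Unary.AllPairs using (_∷_)
open import Data.List.Relation.Unary.Unique.Propositional using (Unique)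
import Data.List.Relation.Unary.Unique.Propositional.Properties as Unique
open import Data.Nat.Base as ℕ using (zero; _+_; _∸_; _<_; _⊔_; s≤s; z≤n; NonZero; s≤s⁻¹)
import Data.Nat.DivMod as ℕ
open import Data.Nat.Divisibility using (divides-refl)
import Data.Nat.Properties as ℕ
open import Data.Product using (∃₂; _×_; _,_; proj₁; proj₂)
open import Data.Rational.Base as ℚ using (ℚ; 1ℚ; 1/_)
import Data.Rational.Properties as ℚ
import Data.Rational.Solver as ℚ-Solver
open import Data.Rational.Unnormalised.Base as ℚᵘ using (mkℚᵘ)
import Data.Rational.Unnormalised.Properties as ℚᵘ
open import Data.Sum.Base using (_⊎_; inj₁; inj₂)
open import Function.Base using (_∘_; _$_)
open import Level using (0ℓ)
open import Relation.Binary.PropositionalEquality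
open import Relation.Nullary using (yes; no; contradiction)
open import Relation.Nullary.Decidable using (_×-dec_; _⊎-dec_; ¬?)
open import Relation.Unary using (Pred; Decidable)

-- Counting

lookup-injective : ∀ {A : Set} {xs : List A} → Unique xs →
                   ∀ {i j} → lookup xs i ≡ lookup xs j → i ≡ j
lookup-injective (_ ∷ _) {Fin.zero} {Fin.zero} _ = refl
lookup-injective {xs = _ ∷ xs} (x∉xs ∷ _) {Fin.zero} {Fin.suc j} eq =
  contradiction eq (All.lookup x∉xs (∈-lookup j))
lookup-injective {xs = _ ∷ xs} (x∉xs ∷ _) {Fin.suc i} {Fin.zero} eq =
  contradiction (sym eq) (All.lookup x∉xs (∈-lookup i))
lookup-injective (_ ∷ xs!) {Fin.suc i} {Fin.suc j} eq = cong Fin.suc (lookup-injective xs! eq)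

module _ {n} {P : Pred (Fin n) 0ℓ} (P? : Decidable P) where

  -- Positions in the filtered list form a finite type of size `count P?`, and the list has no
  -- repetitions, so `g` induces an injection into `Fin d`. Both counts in the construction are
  -- bounded by exhibiting such a numerical code.
  count-injection : ∀ {d} (g : Fin n → ℕ) → (∀ {w} → P w → g w < d) →
                    (∀ {w w′} → P w → P w′ → g w ≡ g w′ → w ≡ w′) → count P? ≤ d
  count-injection {d} g g< g-inj = Fin.injective⇒≤ {f = λ i → fromℕ< (g< (holds i))} injective
    where
    xs : List (Fin n)
    xs = filter P? (allFin n)

    holds : ∀ i → P (lookup xs i)
    holds i = proj₂ (∈-filter⁻ P? {xs = allFin n} (∈-lookup i))

    injective : ∀ {i j} → fromℕ< (g< (holds i)) ≡ fromℕ< (g< (holds j)) → i ≡ j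
    injective {i} {j} eq = lookup-injective (Unique.filter⁺ P? (Unique.allFin⁺ n)) $
      g-inj (holds i) (holds j) $
      trans (sym (Fin.toℕ-fromℕ< (g< (holds i)))) (trans (cong toℕ eq) (Fin.toℕ-fromℕ< (g< (holds j))))

  count+count-¬ : count P? + count (¬? ∘ P?) ≡ n
  count+count-¬ = trans (go (allFin n)) (List.length-tabulate _)
    where
    go : ∀ xs → length (filter P? xs) + length (filter (¬? ∘ P?) xs) ≡ length xs
    go [] = refl
    go (x ∷ xs) with P? x
    ... | yes _ = cong suc (go xs)
    ... | no _  = trans (ℕ.+-suc _ _) (cong suc (go xs))

-- Residues and quotients

-- Adding `a ∸ u`, the inverse of `u` modulo `a`, undoes the translation by `u`. A residue `v < a`
-- is therefore a function `f` of `(u + v) % a`.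
%-cancelˡ-+ : ∀ {a} .{{_ : NonZero a}} {u v w} → u ≤ a → v < a → w < a →
              (u + v) ℕ.% a ≡ (u + w) ℕ.% a → v ≡ w
%-cancelˡ-+ {a} {u} {v} {w} u≤a v<a w<a eq = trans (recover v<a) (trans (cong f eq) (sym (recover w<a)))
  where
  f : ℕ → ℕ
  f s = (s + (a ∸ u) ℕ.% a) ℕ.% a

  recover : ∀ {v} → v < a → v ≡ f ((u + v) ℕ.% a)
  recover {v} v<a = begin
    v                       ≡⟨ ℕ.m<n⇒m%n≡m v<a ⟨
    v ℕ.% a                 ≡⟨ ℕ.[m+n]%n≡m%n v a ⟨
    (v + a) ℕ.% a           ≡⟨ cong (λ s → (v + s) ℕ.% a) (ℕ.m+[n∸m]≡n u≤a) ⟨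
    (v + (u + (a ∸ u))) ℕ.% a ≡⟨ cong (ℕ._% a) (ℕ.+-assoc v u (a ∸ u)) ⟨
    ((v + u) + (a ∸ u)) ℕ.% a ≡⟨ cong (λ s → (s + (a ∸ u)) ℕ.% a) (ℕ.+-comm v u) ⟩
    ((u + v) + (a ∸ u)) ℕ.% a ≡⟨ ℕ.%-distribˡ-+ (u + v) (a ∸ u) a ⟩
    f ((u + v) ℕ.% a)       ∎
    where open ≡-Reasoning

-- The equal quotients cancel, leaving a truncated difference of remainders.
∸-same-block : ∀ d .{{_ : NonZero d}} i j → i ℕ./ d ≡ j ℕ./ d → j ∸ i < d
∸-same-block d i j eq = begin-strict
  j ∸ i                             ≡⟨ cong₂ _∸_ (split j) (trans (split i) (cong (λ q → q * d + i ℕ.% d) eq)) ⟩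
  (q * d + j ℕ.% d) ∸ (q * d + i ℕ.% d) ≡⟨ ℕ.[m+n]∸[m+o]≡n∸o (q * d) (j ℕ.% d) (i ℕ.% d) ⟩
  j ℕ.% d ∸ i ℕ.% d                 ≤⟨ ℕ.m∸n≤m (j ℕ.% d) (i ℕ.% d) ⟩
  j ℕ.% d                           <⟨ ℕ.m%n<n j d ⟩
  d                                 ∎
  where
  open ℕ.≤-Reasoning

  q : ℕ
  q = j ℕ./ d

  split : ∀ i → i ≡ (i ℕ./ d) * d + i ℕ.% d
  split i = trans (ℕ.m≡m%n+[m/n]*n i d) (ℕ.+-comm (i ℕ.% d) _)

-- Applied to residues within a block: the bound 2 is where `2 ≤ k` enters, as a block of k+1
-- positions then contains the residues 0, 1 and 2.
third : ∀ x y → ∃[ r ] r ≤ 2 × r ≢ x × r ≢ y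
third 0 1 = 2 , ℕ.≤-refl , (λ ()) , (λ ())
third 1 0 = 2 , ℕ.≤-refl , (λ ()) , (λ ())
third 0 0 = 1 , s≤s z≤n , (λ ()) , (λ ())
third 0 (suc (suc _)) = 1 , s≤s z≤n , (λ ()) , (λ ())
third (suc (suc _)) 0 = 1 , s≤s z≤n , (λ ()) , (λ ())
third (suc _) (suc _) = 0 , z≤n , (λ ()) , (λ ())

-- Powers of Hamilton cycles

module _ {n} (σ : Permutation′ n) where

  private
    C : Graph n
    C = hamiltonCycle σ

    pos : Fin n → Fin n
    pos = σ ⟨$⟩ˡ_

  pos-injective : ∀ {u v} → pos u ≡ pos v → u ≡ v
  pos-injective eq = trans (sym (inverseʳ σ)) (trans (cong (σ ⟨$⟩ʳ_) eq) (inverseʳ σ))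

  -- The walk moves forward one position at a time. Every position on the way is at most that of
  -- `v`, so the wrap-around edge never occurs.
  segment : ∀ ℓ u v → toℕ (pos v) ≡ ℓ + toℕ (pos u) → Walk C ℓ u v
  segment zero u v eq rewrite pos-injective (Fin.toℕ-injective eq) = []
  segment (suc ℓ) u v eq = step ∷ segment ℓ w v eq′
    where
    p<n : suc (toℕ (pos u)) < n
    p<n = ℕ.≤-<-trans (ℕ.≤-trans (s≤s (ℕ.m≤n+m _ ℓ)) (ℕ.≤-reflexive (sym eq))) (Fin.toℕ<n (pos v))

    w : Fin n
    w = σ ⟨$⟩ʳ fromℕ< p<n

    pos-w : toℕ (pos w) ≡ suc (toℕ (pos u))
    pos-w = trans (cong toℕ (inverseˡ σ)) (Fin.toℕ-fromℕ< p<n)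

    step : Graph.Adj C u w
    step = (λ u≡w → ℕ.1+n≢n (trans (sym pos-w) (cong (toℕ ∘ pos) (sym u≡w)))) , inj₁ (inj₁ pos-w)

    eq′ : toℕ (pos v) ≡ ℓ + toℕ (pos w)
    eq′ = trans eq (trans (sym (ℕ.+-suc ℓ _)) (cong (ℓ ℕ.+_) (sym pos-w)))

  -- Positions in the same block of length k+1 differ by at most k, so each block is a clique of the
  -- power. The walk found runs forward and is reversed when `v` comes first.
  power-same-block : ∀ k {u v} → u ≢ v →
    toℕ (pos u) ℕ./ suc k ≡ toℕ (pos v) ℕ./ suc k → Graph.Adj (power k C) u v
  power-same-block k {u} {v} u≢v eq with ℕ.≤-total (toℕ (pos u)) (toℕ (pos v))
  ... | inj₁ u≤v = u≢v , _ , s≤s⁻¹ (∸-same-block (suc k) (toℕ (pos u)) (toℕ (pos v)) eq) ,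
                   segment _ u v (sym (ℕ.m∸n+n≡m u≤v))
  ... | inj₂ v≤u = u≢v , _ , s≤s⁻¹ (∸-same-block (suc k) (toℕ (pos v)) (toℕ (pos u)) (sym eq)) ,
                   walk-sym C (segment _ v u (sym (ℕ.m∸n+n≡m v≤u)))

-- The incompatibility system

module Construction (m k e : ℕ) (2≤k : 2 ≤ k) (1≤m : 1 ≤ m) (e≤m : e ≤ m) where

  N : ℕ
  N = m * suc k

  -- The set A, taken as an initial segment so that its labels 0, ..., m represent each residue
  -- modulo m+1 exactly once.
  Special : Pred (Fin N) 0ℓ
  Special u = toℕ u ≤ m

  -- For two vertices of A only the last alternative can hold; it is the Cayley sum graph of ℤ/(m+1)
  -- with connection set {0, ..., e-1}, loops removed. The first two alternatives join each vertex
  -- outside A to all others.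
  G : Graph N
  G .Graph.Adj u w = u ≢ w × (m < toℕ u ⊎ m < toℕ w ⊎ (toℕ u + toℕ w) ℕ.% suc m < e)
  G .Graph.adj? u w =
    ¬? (u Fin.≟ w) ×-dec ((m ℕ.<? toℕ u) ⊎-dec (m ℕ.<? toℕ w) ⊎-dec (_ ℕ.<? e))
  G .Graph.symm (u≢w , inj₁ m<u) = u≢w ∘ sym , inj₂ (inj₁ m<u)
  G .Graph.symm (u≢w , inj₂ (inj₁ m<w)) = u≢w ∘ sym , inj₁ m<w
  G .Graph.symm {u} {w} (u≢w , inj₂ (inj₂ s<e)) = u≢w ∘ sym ,
    inj₂ (inj₂ (subst (λ s → s ℕ.% suc m < e) (ℕ.+-comm (toℕ u) (toℕ w)) s<e))
  G .Graph.irrefl (v≢v , _) = v≢v refl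

  open Graph G

  F : IncompatibilitySystem G
  F .IncompatibilitySystem.Incompatible v u w =
    (Special u × Special w) × Adj u w × Adj v u × Adj v w
  F .IncompatibilitySystem.incompatible? v u w =
    ((_ ℕ.≤? m) ×-dec (_ ℕ.≤? m)) ×-dec adj? u w ×-dec adj? v u ×-dec adj? v w
  F .IncompatibilitySystem.symmetric v ((u∈ , w∈) , uw , vu , vw) = (w∈ , u∈) , symm uw , vw , vu
  F .IncompatibilitySystem.distinct (_ , (u≢w , _) , _) = u≢w
  F .IncompatibilitySystem.edges (_ , _ , vuw) = vuw

  open IncompatibilitySystem F

  -- Once `u` is fixed in A, the residue of the sum identifies its partner in A; it serves as the
  -- code for both neighbours and non-neighbours.
  sum-injective : ∀ {u w w′ : Fin N} → Special u → Special w → Special w′ →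
    (toℕ u + toℕ w) ℕ.% suc m ≡ (toℕ u + toℕ w′) ℕ.% suc m → w ≡ w′
  sum-injective u∈ w∈ w′∈ eq =
    Fin.toℕ-injective (%-cancelˡ-+ (ℕ.m≤n⇒m≤1+n u∈) (s≤s w∈) (s≤s w′∈) eq)

  small-sum : ∀ {u w} → Special u → Special w → Adj u w → (toℕ u + toℕ w) ℕ.% suc m < e
  small-sum u∈ w∈ (_ , inj₁ m<u) = contradiction u∈ (ℕ.<⇒≱ m<u)
  small-sum u∈ w∈ (_ , inj₂ (inj₁ m<w)) = contradiction w∈ (ℕ.<⇒≱ m<w)
  small-sum u∈ w∈ (_ , inj₂ (inj₂ s<e)) = s<e

  -- Whatever `v` is, the partners of `u` are neighbours of `u` in the sum graph, and these are
  -- coded by residues below `e`.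
  incompatible-count : ∀ v u → count (incompatible? v u) ≤ e
  incompatible-count v u = count-injection (incompatible? v u)
    (λ w → (toℕ u + toℕ w) ℕ.% suc m)
    (λ ((u∈ , w∈) , uw , _) → small-sum u∈ w∈ uw)
    (λ ((u∈ , w∈) , _) ((_ , w′∈) , _) → sum-injective u∈ w∈ w′∈)

  nonadjacent : ∀ {u w} → u ≢ w → ¬ Adj u w →
    Special u × Special w × e ≤ (toℕ u + toℕ w) ℕ.% suc m
  nonadjacent u≢w ¬uw =
    ℕ.≮⇒≥ (λ m<u → ¬uw (u≢w , inj₁ m<u)) ,
    ℕ.≮⇒≥ (λ m<w → ¬uw (u≢w , inj₂ (inj₁ m<w))) ,
    ℕ.≮⇒≥ (λ s<e → ¬uw (u≢w , inj₂ (inj₂ s<e)))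

  -- The code 0 is reserved for `u` itself, which is not its own neighbour. The other non-neighbours
  -- have sums with residues e, ..., m, shifted down to start at 1.
  codegree : ∀ u → count (¬? ∘ adj? u) ≤ suc (suc m ∸ e)
  codegree u = count-injection (¬? ∘ adj? u) g g< g-inj
    where
    g : Fin N → ℕ
    g w with u Fin.≟ w
    ... | yes _ = 0
    ... | no _  = suc ((toℕ u + toℕ w) ℕ.% suc m ∸ e)

    g< : ∀ {w} → ¬ Adj u w → g w < suc (suc m ∸ e)
    g< {w} ¬uw with u Fin.≟ w
    ... | yes _  = s≤s z≤n
    ... | no u≢w = s≤s (ℕ.∸-monoˡ-< (ℕ.m%n<n (toℕ u + toℕ w) (suc m))
                          (proj₂ (proj₂ (nonadjacent u≢w ¬uw))))

    g-inj : ∀ {w w′} → ¬ Adj u w → ¬ Adj u w′ → g w ≡ g w′ → w ≡ w′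
    g-inj {w} {w′} ¬uw ¬uw′ eq with u Fin.≟ w | u Fin.≟ w′
    ... | yes refl | yes refl = refl
    ... | no u≢w   | no u≢w′  =
      let u∈ , w∈ , e≤s = nonadjacent u≢w ¬uw
          _ , w′∈ , e≤s′ = nonadjacent u≢w′ ¬uw′
      in sum-injective u∈ w∈ w′∈ (ℕ.∸-cancelʳ-≡ e≤s e≤s′ (ℕ.suc-injective eq))

  -- Counting non-neighbours out of N = mk + m loses 2: one for `u` itself and one because A has m+1
  -- rather than m vertices. The additive form avoids truncated subtraction.
  degree-bound : ∀ u → m * k + e ≤ degree G u + 2
  degree-bound u = ℕ.+-cancelʳ-≤ m _ _ $ begin
    m * k + e + m                   ≡⟨ trans (ℕ.+-assoc (m * k) e m) (cong (m * k ℕ.+_) (ℕ.+-comm e m)) ⟩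
    m * k + (m + e)                 ≡⟨ ℕ.+-assoc (m * k) m e ⟨
    m * k + m + e                   ≡⟨ cong (_+ e) (trans (ℕ.+-comm (m * k) m) (sym (ℕ.*-suc m k))) ⟩
    N + e                           ≡⟨ cong (_+ e) (count+count-¬ (adj? u)) ⟨
    degree G u + count (¬? ∘ adj? u) + e ≤⟨ ℕ.+-monoˡ-≤ e (ℕ.+-monoʳ-≤ (degree G u) (codegree u)) ⟩
    degree G u + suc (suc m ∸ e) + e     ≡⟨ ℕ.+-assoc (degree G u) _ e ⟩
    degree G u + suc (suc m ∸ e + e)     ≡⟨ cong (λ t → degree G u + suc t) (ℕ.m∸n+n≡m (ℕ.m≤n⇒m≤1+n e≤m)) ⟩
    degree G u + (2 + m)                 ≡⟨ ℕ.+-assoc (degree G u) 2 m ⟨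
    degree G u + 2 + m              ∎
    where open ℕ.≤-Reasoning

  1+m≤N : suc m ≤ N
  1+m≤N = begin
    suc m     ≤⟨ ℕ.+-monoˡ-≤ m 1≤m ⟩
    m + m     ≡⟨ cong (m ℕ.+_) (ℕ.*-identityʳ m) ⟨
    m + m * 1 ≤⟨ ℕ.+-monoʳ-≤ m (ℕ.*-monoʳ-≤ m (ℕ.≤-trans (s≤s z≤n) 2≤k)) ⟩
    m + m * k ≡⟨ ℕ.*-suc m k ⟨
    N         ∎
    where open ℕ.≤-Reasoning

  -- Blocks of k+1 consecutive positions

  module _ (σ : Permutation′ N) where

    private
      block : Fin N → ℕ
      block u = toℕ (σ ⟨$⟩ˡ u) ℕ./ suc k

      residue : Fin N → ℕ
      residue u = toℕ (σ ⟨$⟩ˡ u) ℕ.% suc k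

      block< : ∀ u → block u < m
      block< u = ℕ.m<n*o⇒m/o<n (Fin.toℕ<n (σ ⟨$⟩ˡ u))

    special-pair : ∃₂ λ u w → u ≢ w × Special u × Special w × block u ≡ block w
    special-pair with i , j , i<j , eq ← Fin.pigeonhole (ℕ.n<1+n m) (λ i → fromℕ< (block< (inject≤ i 1+m≤N))) =
      inject≤ i 1+m≤N , inject≤ j 1+m≤N ,
      (λ i≡j → ℕ.<⇒≢ i<j (trans (sym (Fin.toℕ-inject≤ i 1+m≤N)) (trans (cong toℕ i≡j) (Fin.toℕ-inject≤ j 1+m≤N)))) ,
      special i , special j ,
      trans (sym (Fin.toℕ-fromℕ< (block< _))) (trans (cong toℕ eq) (Fin.toℕ-fromℕ< (block< _)))
      where
      special : ∀ i → Special (inject≤ i 1+m≤N)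
      special i = ℕ.≤-trans (ℕ.≤-reflexive (Fin.toℕ-inject≤ i 1+m≤N)) (s≤s⁻¹ (Fin.toℕ<n i))

    -- The vertex is specified by its position: the quotient of `u` with a new residue. Differing in
    -- residue from `u` and `w`, it differs from both.
    third-in-block : ∀ u w → ∃[ v ] v ≢ u × v ≢ w × block v ≡ block u
    third-in-block u w with r , r≤2 , r≢u , r≢w ← third (residue u) (residue w) =
      v , (λ v≡u → r≢u (trans (sym v%) (cong residue v≡u))) ,
          (λ v≡w → r≢w (trans (sym v%) (cong residue v≡w))) , v/
      where
      r<K : r < suc k
      r<K = s≤s (ℕ.≤-trans r≤2 2≤k)

      p : ℕ
      p = r + block u * suc k

      p<N : p < N
      p<N = ℕ.≤-trans (ℕ.+-monoˡ-≤ (block u * suc k) r<K) (ℕ.*-monoˡ-≤ (suc k) (block< u))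

      v : Fin N
      v = σ ⟨$⟩ʳ fromℕ< p<N

      pos-v : toℕ (σ ⟨$⟩ˡ v) ≡ p
      pos-v = trans (cong toℕ (inverseˡ σ)) (Fin.toℕ-fromℕ< p<N)

      v% : residue v ≡ r
      v% = trans (cong (ℕ._% suc k) pos-v) (trans (ℕ.[m+kn]%n≡m%n r (block u) (suc k)) (ℕ.m<n⇒m%n≡m r<K))

      v/ : block v ≡ block u
      v/ = begin
        toℕ (σ ⟨$⟩ˡ v) ℕ./ suc k                  ≡⟨ cong (ℕ._/ suc k) pos-v ⟩
        (r + block u * suc k) ℕ./ suc k           ≡⟨ ℕ.+-distrib-/-∣ʳ r (divides-refl (block u)) ⟩
        r ℕ./ suc k + (block u * suc k) ℕ./ suc k ≡⟨ cong₂ _+_ (ℕ.m<n⇒m/n≡0 r<K) (ℕ.m*n/n≡m (block u) (suc k)) ⟩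
        block u                                   ∎
        where open ≡-Reasoning

  no-compatible-power : ¬ ContainsCompatibleHamiltonPower k F
  no-compatible-power (σ , ⊆G , compatible)
    with u , w , u≢w , u∈ , w∈ , bu≡bw ← special-pair σ
    with v , v≢u , v≢w , bv≡bu ← third-in-block σ u w =
    -- The block is a clique of the power, so containment in `G` makes `uw` an edge inside A, which
    -- renders `vu` and `vw` incompatible.
    compatible vu vw u≢w ((u∈ , w∈) , ⊆G (power-same-block σ k u≢w bu≡bw) , ⊆G vu , ⊆G vw)
    where
    vu = power-same-block σ k v≢u bv≡bu
    vw = power-same-block σ k v≢w (trans bv≡bu bu≡bw)

-- Rational approximation

-- Together with `fromℚᵘ-homo-*`, this reduces identities for `ℕ→ℚ` to cross-multiplication of
-- integers in unnormalised fractions.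
fromℚᵘ-homo-+ : ∀ p q → ℚ.fromℚᵘ (p ℚᵘ.+ q) ≡ ℚ.fromℚᵘ p ℚ.+ ℚ.fromℚᵘ q
fromℚᵘ-homo-+ p q = ℚ.toℚᵘ-injective $ begin
  ℚ.toℚᵘ (ℚ.fromℚᵘ (p ℚᵘ.+ q))                       ≈⟨ ℚ.toℚᵘ-fromℚᵘ (p ℚᵘ.+ q) ⟩
  p ℚᵘ.+ q                                           ≈⟨ ℚᵘ.+-cong (ℚ.toℚᵘ-fromℚᵘ p) (ℚ.toℚᵘ-fromℚᵘ q) ⟨
  ℚ.toℚᵘ (ℚ.fromℚᵘ p) ℚᵘ.+ ℚ.toℚᵘ (ℚ.fromℚᵘ q)       ≈⟨ ℚ.toℚᵘ-homo-+ (ℚ.fromℚᵘ p) (ℚ.fromℚᵘ q) ⟨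
  ℚ.toℚᵘ (ℚ.fromℚᵘ p ℚ.+ ℚ.fromℚᵘ q)                 ∎
  where open ℚᵘ.≃-Reasoning

fromℚᵘ-homo-* : ∀ p q → ℚ.fromℚᵘ (p ℚᵘ.* q) ≡ ℚ.fromℚᵘ p ℚ.* ℚ.fromℚᵘ q
fromℚᵘ-homo-* p q = ℚ.toℚᵘ-injective $ begin
  ℚ.toℚᵘ (ℚ.fromℚᵘ (p ℚᵘ.* q))                       ≈⟨ ℚ.toℚᵘ-fromℚᵘ (p ℚᵘ.* q) ⟩
  p ℚᵘ.* q                                           ≈⟨ ℚᵘ.*-cong (ℚ.toℚᵘ-fromℚᵘ p) (ℚ.toℚᵘ-fromℚᵘ q) ⟨
  ℚ.toℚᵘ (ℚ.fromℚᵘ p) ℚᵘ.* ℚ.toℚᵘ (ℚ.fromℚᵘ q)       ≈⟨ ℚ.toℚᵘ-homo-* (ℚ.fromℚᵘ p) (ℚ.fromℚᵘ q) ⟨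
  ℚ.toℚᵘ (ℚ.fromℚᵘ p ℚ.* ℚ.fromℚᵘ q)                 ∎
  where open ℚᵘ.≃-Reasoning

ℕ→ℚ-homo-+ : ∀ a b → ℕ→ℚ (a + b) ≡ ℕ→ℚ a ℚ.+ ℕ→ℚ b
ℕ→ℚ-homo-+ a b = trans
  (ℚ.fromℚᵘ-cong {mkℚᵘ (+ (a + b)) 0} {mkℚᵘ (+ a) 0 ℚᵘ.+ mkℚᵘ (+ b) 0}
    (ℚᵘ.*≡* (cong (ℤ._* + 1) (sym (cong₂ ℤ._+_ (ℤ.*-identityʳ (+ a)) (ℤ.*-identityʳ (+ b)))))))
  (fromℚᵘ-homo-+ (mkℚᵘ (+ a) 0) (mkℚᵘ (+ b) 0))

ℕ→ℚ-*-/ : ∀ m a d → ℕ→ℚ (m * suc d) ℚ.* (+ a / suc d) ≡ ℕ→ℚ (m * a)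
ℕ→ℚ-*-/ m a d = trans
  (sym (fromℚᵘ-homo-* (mkℚᵘ (+ (m * suc d)) 0) (mkℚᵘ (+ a) d)))
  (ℚ.fromℚᵘ-cong {mkℚᵘ (+ (m * suc d)) 0 ℚᵘ.* mkℚᵘ (+ a) d} {mkℚᵘ (+ (m * a)) 0} (ℚᵘ.*≡* eq))
  where
  open ≡-Reasoning
  eq : (+ (m * suc d) ℤ.* + a) ℤ.* + 1 ≡ + (m * a) ℤ.* + (1 * suc d)
  eq = begin
    (+ (m * suc d) ℤ.* + a) ℤ.* + 1 ≡⟨ ℤ.*-identityʳ _ ⟩
    + (m * suc d) ℤ.* + a           ≡⟨ ℤ.pos-* (m * suc d) a ⟨
    + (m * suc d * a)               ≡⟨ cong +_ (trans (ℕ.*-assoc m (suc d) a) (trans (cong (m ℕ.*_) (ℕ.*-comm (suc d) a)) (sym (ℕ.*-assoc m a (suc d))))) ⟩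
    + (m * a * suc d)               ≡⟨ cong (λ t → + (m * a * t)) (ℕ.*-identityˡ (suc d)) ⟨
    + (m * a * (1 * suc d))         ≡⟨ ℤ.pos-* (m * a) (1 * suc d) ⟩
    + (m * a) ℤ.* + (1 * suc d)     ∎

0≤ℕ→ℚ : ∀ a → 0ℚ ℚ.≤ ℕ→ℚ a
0≤ℕ→ℚ a = ℚ.nonNegative⁻¹ (ℕ→ℚ a) {{ℚ.normalize-nonNeg a 1}}

ℕ→ℚ-mono-≤ : ∀ {a b} → a ≤ b → ℕ→ℚ a ℚ.≤ ℕ→ℚ b
ℕ→ℚ-mono-≤ {a} {b} a≤b = begin
  ℕ→ℚ a                   ≡⟨ ℚ.+-identityʳ (ℕ→ℚ a) ⟨
  ℕ→ℚ a ℚ.+ 0ℚ            ≤⟨ ℚ.+-monoʳ-≤ (ℕ→ℚ a) (0≤ℕ→ℚ (b ∸ a)) ⟩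
  ℕ→ℚ a ℚ.+ ℕ→ℚ (b ∸ a)   ≡⟨ ℕ→ℚ-homo-+ a (b ∸ a) ⟨
  ℕ→ℚ (a + (b ∸ a))       ≡⟨ cong ℕ→ℚ (ℕ.m+[n∸m]≡n a≤b) ⟩
  ℕ→ℚ b                   ∎
  where open ℚ.≤-Reasoning

ℕ→ℚ-cancel-≤ : ∀ {a b} → ℕ→ℚ a ℚ.≤ ℕ→ℚ b → a ≤ b
ℕ→ℚ-cancel-≤ {a} {b} a≤b with a ℕ.≤? b
... | yes p = p
... | no a≰b = contradiction refl (ℚ.<⇒≢ (ℚ.<-≤-trans b<1+b (ℚ.≤-trans (ℕ→ℚ-mono-≤ (ℕ.≰⇒> a≰b)) a≤b)))
  where
  b<1+b : ℕ→ℚ b ℚ.< ℕ→ℚ (suc b)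
  b<1+b = subst₂ ℚ._<_ (ℚ.+-identityˡ (ℕ→ℚ b)) (sym (ℕ→ℚ-homo-+ 1 b))
    (ℚ.+-monoˡ-< (ℕ→ℚ b) (ℚ.positive⁻¹ 1ℚ))

-- A nonnegative fraction is at most its numerator; a negative one is at most 0.
archimedean : ∀ x → ∃[ N ] x ℚ.≤ ℕ→ℚ N
archimedean x@(ℚ.mkℚ (+ a) d _) = a , ℚ.toℚᵘ-cancel-≤ (begin
  ℚ.toℚᵘ x              ≤⟨ ℚᵘ.*≤* (subst₂ ℤ._≤_ (ℤ.pos-* a 1) (ℤ.pos-* a (suc d)) (ℤ.+≤+ (ℕ.*-monoʳ-≤ a (s≤s z≤n)))) ⟩
  mkℚᵘ (+ a) 0          ≃⟨ ℚ.toℚᵘ-fromℚᵘ (mkℚᵘ (+ a) 0) ⟨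
  ℚ.toℚᵘ (ℕ→ℚ a)        ∎)
  where open ℚᵘ.≤-Reasoning
archimedean x@(ℚ.mkℚ ℤ.-[1+ _ ] _ _) = 0 , ℚ.<⇒≤ (ℚ.negative⁻¹ x)

-- Descends from the bound `N`. Both inequalities are weak, so an integer `x` may be assigned
-- `x - 1`.
floor : ∀ N {x} → 0ℚ ℚ.≤ x → x ℚ.≤ ℕ→ℚ N → ∃[ e ] ℕ→ℚ e ℚ.≤ x × x ℚ.≤ ℕ→ℚ (suc e)
floor zero 0≤x x≤0 = 0 , 0≤x , ℚ.≤-trans x≤0 (ℕ→ℚ-mono-≤ {0} {1} z≤n)
floor (suc N) {x} 0≤x x≤1+N with ℚ.≤-total x (ℕ→ℚ N)
... | inj₁ x≤N = floor N 0≤x x≤N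
... | inj₂ N≤x = N , N≤x , x≤1+N

≤-from-difference : ∀ {p q} → 0ℚ ℚ.≤ q ℚ.- p → p ℚ.≤ q
≤-from-difference {p} {q} 0≤q-p = subst₂ ℚ._≤_ (ℚ.+-identityˡ p) eq (ℚ.+-monoˡ-≤ p 0≤q-p)
  where
  eq : q ℚ.- p ℚ.+ p ≡ q
  eq = trans (ℚ.+-assoc q (ℚ.- p) p) (trans (cong (q ℚ.+_) (ℚ.+-inverseˡ p)) (ℚ.+-identityʳ q))

difference-nonNeg : ∀ {p q} → p ℚ.≤ q → 0ℚ ℚ.≤ q ℚ.- p
difference-nonNeg {p} {q} p≤q = subst (ℚ._≤ q ℚ.- p) (ℚ.+-inverseʳ p) (ℚ.+-monoˡ-≤ (ℚ.- p) p≤q)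

+-cancelʳ-≤ : ∀ r {p q} → p ℚ.+ r ℚ.≤ q ℚ.+ r → p ℚ.≤ q
+-cancelʳ-≤ r {p} {q} p+r≤q+r = subst₂ ℚ._≤_ (eq p) (eq q) (ℚ.+-monoˡ-≤ (ℚ.- r) p+r≤q+r)
  where
  eq : ∀ p → p ℚ.+ r ℚ.- r ≡ p
  eq p = trans (ℚ.+-assoc p r (ℚ.- r)) (trans (cong (p ℚ.+_) (ℚ.+-inverseʳ r)) (ℚ.+-identityʳ p))

p≤∣p∣ : ∀ p → p ℚ.≤ ℚ.∣ p ∣
p≤∣p∣ p with ℚ.≤-total 0ℚ p
... | inj₁ 0≤p = ℚ.≤-reflexive (sym (ℚ.0≤p⇒∣p∣≡p 0≤p))
... | inj₂ p≤0 = ℚ.≤-trans p≤0 (ℚ.0≤∣p∣ p)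

-- Rational windows around real numbers

open ℝ

-- From `threshold` on, all approximations of `x` lie between `lo` and `hi`, so estimates on `x`
-- become estimates on rationals. The field `gap+½hi≤lo` leaves room, for large n, for an integer e
-- between n·hi/2 + 2 and n·lo; `lo≤c` will keep e at most m.
record Enclosure (x : ℝ) (c : ℚ) : Set where
  field
    lo hi gap : ℚ
    0<gap     : 0ℚ ℚ.< gap
    gap+½hi≤lo : gap ℚ.+ ½ ℚ.* hi ℚ.≤ lo
    0≤lo      : 0ℚ ℚ.≤ lo
    lo≤c      : lo ℚ.≤ c
    threshold : ℕ
    lo≤       : ∀ i → threshold ≤ i → lo ℚ.≤ approx x i
    ≤hi       : ∀ i → threshold ≤ i → approx x i ℚ.≤ hi

-- With ε a lower bound of x, the radius ε/4 makes lo - hi/2 ≥ ε/8.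
enclose : ∀ x c → fromℚ 0ℚ <ᴿ x → x <ᴿ fromℚ c → Enclosure x c
enclose x c (ε , 0<ε , N₁ , 0+ε≤) (ε′ , 0<ε′ , N₂ , +ε′≤c) = record
  { lo = lo
  ; hi = hi
  ; gap = t
  ; 0<gap = 0<t
  ; gap+½hi≤lo = ≤-from-difference (subst (0ℚ ℚ.≤_)
      (solve 2 (λ q t → con ½ :* (q :- con 8ℚ :* t) :=
                        (q :- con 2ℚ :* t) :- (t :+ con ½ :* (q :+ con 2ℚ :* t))) refl q t)
      (subst (ℚ._≤ ½ ℚ.* (q ℚ.- 8ℚ ℚ.* t)) (ℚ.*-zeroʳ ½)
        (ℚ.*-monoˡ-≤-nonNeg ½ (difference-nonNeg 8t≤q))))
  ; 0≤lo = difference-nonNeg (ℚ.≤-trans (ℚ.*-monoʳ-≤-nonNeg t {{ℚ.nonNegative (ℚ.<⇒≤ 0<t)}} 2≤8) 8t≤q)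
  ; lo≤c = begin
      lo         ≤⟨ ℚ.+-monoʳ-≤ q (ℚ.neg-antimono-≤ (ℚ.<⇒≤ 0<2t)) ⟩
      q ℚ.+ 0ℚ   ≤⟨ ℚ.+-monoʳ-≤ q (ℚ.<⇒≤ 0<ε′) ⟩
      q ℚ.+ ε′   ≤⟨ +ε′≤c N (ℕ.≤-trans (ℕ.m≤n⊔m N₁ N₂) (ℕ.m≤m⊔n (N₁ ⊔ N₂) N₃)) ⟩
      c          ∎
  ; threshold = N
  ; lo≤ = λ i N≤i → ≤-from-difference (subst (0ℚ ℚ.≤_)
      (solve 3 (λ q y r → r :- (q :- y) := y :- (q :- r)) refl q (approx x i) 2t)
      (difference-nonNeg (ℚ.≤-trans (p≤∣p∣ _) (close N i ℕ.≤-refl N≤i))))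
  ; ≤hi = λ i N≤i → ≤-from-difference (subst (0ℚ ℚ.≤_)
      (solve 3 (λ q y r → r :- (y :- q) := (q :+ r) :- y) refl q (approx x i) 2t)
      (difference-nonNeg (ℚ.≤-trans (p≤∣p∣ _) (close i N N≤i ℕ.≤-refl))))
  }
  where
  open ℚ-Solver.+-*-Solver
  open ℚ.≤-Reasoning

  2ℚ 8ℚ t 2t q lo hi : ℚ
  2ℚ = ℕ→ℚ 2
  8ℚ = ℕ→ℚ 8
  t = 1/ 8ℚ ℚ.* ε
  2t = 2ℚ ℚ.* t

  0<t : 0ℚ ℚ.< t
  0<t = subst (ℚ._< t) (ℚ.*-zeroʳ (1/ 8ℚ)) (ℚ.*-monoʳ-<-pos (1/ 8ℚ) 0<ε)

  0<2t : 0ℚ ℚ.< 2t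
  0<2t = subst (ℚ._< 2t) (ℚ.*-zeroʳ 2ℚ) (ℚ.*-monoʳ-<-pos 2ℚ 0<t)

  2≤8 : 2ℚ ℚ.≤ 8ℚ
  2≤8 = ℕ→ℚ-mono-≤ {2} {8} (s≤s (s≤s z≤n))

  N₃ N : ℕ
  N₃ = proj₁ (cauchy x 2t 0<2t)
  -- Past `N` the approximations are at least ε, at most c - ε′, and within `2t` of each other; the
  -- one at `N` is the centre of the window.
  N = N₁ ⊔ N₂ ⊔ N₃

  q = approx x N
  lo = q ℚ.- 2t
  hi = q ℚ.+ 2t

  close : ∀ i j → N ≤ i → N ≤ j → ℚ.∣ approx x i ℚ.- approx x j ∣ ℚ.≤ 2t
  close i j N≤i N≤j = proj₂ (cauchy x 2t 0<2t) i j
    (ℕ.≤-trans (ℕ.m≤n⊔m (N₁ ⊔ N₂) N₃) N≤i) (ℕ.≤-trans (ℕ.m≤n⊔m (N₁ ⊔ N₂) N₃) N≤j)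

  8t≤q : 8ℚ ℚ.* t ℚ.≤ q
  8t≤q = begin
    8ℚ ℚ.* t   ≡⟨ solve 1 (λ ε → con 8ℚ :* (con (1/ 8ℚ) :* ε) := con 0ℚ :+ ε) refl ε ⟩
    0ℚ ℚ.+ ε   ≤⟨ 0+ε≤ N (ℕ.≤-trans (ℕ.m≤m⊔n N₁ N₂) (ℕ.m≤m⊔n (N₁ ⊔ N₂) N₃)) ⟩
    q          ∎

-- Scaling by n and the choice of e

*-monoˡ-≤-ℕ→ℚ : ∀ n {p q} → p ℚ.≤ q → ℕ→ℚ n ℚ.* p ℚ.≤ ℕ→ℚ n ℚ.* q
*-monoˡ-≤-ℕ→ℚ n = ℚ.*-monoˡ-≤-nonNeg (ℕ→ℚ n) {{ℚ.normalize-nonNeg n 1}}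

-- Turns inequalities valid at all late indices into `≤ᴿ`, whose definition allows a slack ε.
≤⇒≤+ε : ∀ {p q ε} → p ℚ.≤ q → 0ℚ ℚ.< ε → p ℚ.≤ q ℚ.+ ε
≤⇒≤+ε {q = q} p≤q 0<ε = ℚ.≤-trans p≤q
  (subst (ℚ._≤ q ℚ.+ _) (ℚ.+-identityʳ q) (ℚ.+-monoʳ-≤ q (ℚ.<⇒≤ 0<ε)))

mainTheorem2 : (k : ℕ) → 2 ≤ k →
    (μ : ℝ) → fromℚ 0ℚ <ᴿ μ → μ <ᴿ fromℚ (+ 1 / (2 * suc k)) →
    ∃[ n₀ ] ∀ (n : ℕ) → n₀ ≤ n → suc k ∣ n →
    Σ (BoundedIncompatibilitySystem n (fromℚ (+ k / suc k) +ᴿ ½ · μ) μ) λ S →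
    ¬ ContainsCompatibleHamiltonPower k (BoundedIncompatibilitySystem.F S)
mainTheorem2 k 2≤k μ 0<μ μ<c = n₀ , λ { .(m * suc k) n₀≤n (divides-refl m) → system m n₀≤n }
  where
  open ℚ.≤-Reasoning

  c : ℚ
  c = + 1 / (2 * suc k)

  open Enclosure (enclose μ c 0<μ μ<c)

  instance
    gap-pos : ℚ.Positive gap
    gap-pos = ℚ.positive 0<gap

    gap-nonNeg : ℚ.NonNegative gap
    gap-nonNeg = ℚ.pos⇒nonNeg gap

    gap-nonZero : ℚ.NonZero gap
    gap-nonZero = ℚ.pos⇒nonZero gap

    c-nonNeg : ℚ.NonNegative c
    c-nonNeg = ℚ.normalize-nonNeg 1 (2 * suc k)

  -- Large enough for n·gap ≥ 3: two units cover the loss in `degree-bound`, one covers rounding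
  -- n·lo down to e.
  n₀ : ℕ
  n₀ = proj₁ (archimedean (ℕ→ℚ 3 ℚ.* 1/ gap))

  module _ (m : ℕ) (n₀≤n : n₀ ≤ m * suc k) where

    n : ℕ
    n = m * suc k

    3≤n*gap : ℕ→ℚ 3 ℚ.≤ ℕ→ℚ n ℚ.* gap
    3≤n*gap = begin
      ℕ→ℚ 3                        ≡⟨ ℚ.*-identityʳ (ℕ→ℚ 3) ⟨
      ℕ→ℚ 3 ℚ.* 1ℚ                 ≡⟨ cong (ℕ→ℚ 3 ℚ.*_) (ℚ.*-inverseˡ gap) ⟨
      ℕ→ℚ 3 ℚ.* (1/ gap ℚ.* gap)   ≡⟨ ℚ.*-assoc (ℕ→ℚ 3) (1/ gap) gap ⟨
      ℕ→ℚ 3 ℚ.* 1/ gap ℚ.* gap     ≤⟨ ℚ.*-monoʳ-≤-nonNeg gap (ℚ.≤-trans (proj₂ (archimedean (ℕ→ℚ 3 ℚ.* 1/ gap))) (ℕ→ℚ-mono-≤ n₀≤n)) ⟩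
      ℕ→ℚ n ℚ.* gap                ∎

    -- Here n ≤ m · 2(k+1), and multiplying the right side by `c` gives m.
    n*lo≤m : ℕ→ℚ n ℚ.* lo ℚ.≤ ℕ→ℚ m
    n*lo≤m = begin
      ℕ→ℚ n ℚ.* lo                 ≤⟨ *-monoˡ-≤-ℕ→ℚ n lo≤c ⟩
      ℕ→ℚ n ℚ.* c                  ≤⟨ ℚ.*-monoʳ-≤-nonNeg c (ℕ→ℚ-mono-≤ (ℕ.*-monoʳ-≤ m (ℕ.m≤m+n (suc k) _))) ⟩
      ℕ→ℚ (m * (2 * suc k)) ℚ.* c  ≡⟨ ℕ→ℚ-*-/ m 1 _ ⟩
      ℕ→ℚ (m * 1)                  ≡⟨ cong ℕ→ℚ (ℕ.*-identityʳ m) ⟩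
      ℕ→ℚ m                        ∎

    0≤n*lo : 0ℚ ℚ.≤ ℕ→ℚ n ℚ.* lo
    0≤n*lo = subst (ℚ._≤ ℕ→ℚ n ℚ.* lo) (ℚ.*-zeroʳ (ℕ→ℚ n)) (*-monoˡ-≤-ℕ→ℚ n 0≤lo)

    rounded : ∃[ e ] ℕ→ℚ e ℚ.≤ ℕ→ℚ n ℚ.* lo × ℕ→ℚ n ℚ.* lo ℚ.≤ ℕ→ℚ (suc e)
    rounded = floor m 0≤n*lo n*lo≤m

    e : ℕ
    e = proj₁ rounded

    e≤n*lo : ℕ→ℚ e ℚ.≤ ℕ→ℚ n ℚ.* lo
    e≤n*lo = proj₁ (proj₂ rounded)

    e≤m : e ≤ m
    e≤m = ℕ→ℚ-cancel-≤ (ℚ.≤-trans e≤n*lo n*lo≤m)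

    -- With m = 0 also n = 0, contradicting 3 ≤ n·gap.
    1≤m : 1 ≤ m
    1≤m = ℕ.n≢0⇒n>0 λ m≡0 → contradiction
      (ℕ→ℚ-cancel-≤ {3} {0} (ℚ.≤-trans 3≤n*gap (ℚ.≤-reflexive
        (trans (cong (λ m → ℕ→ℚ (m * suc k) ℚ.* gap) m≡0) (ℚ.*-zeroˡ gap)))))
      λ ()

    n*½hi+2≤e : ℕ→ℚ n ℚ.* (½ ℚ.* hi) ℚ.+ ℕ→ℚ 2 ℚ.≤ ℕ→ℚ e
    -- Adding 1 replaces e by `suc e`, which rounding guarantees to be at least n·lo.
    n*½hi+2≤e = +-cancelʳ-≤ 1ℚ $ begin
      h ℚ.+ ℕ→ℚ 2 ℚ.+ 1ℚ             ≡⟨ ℚ.+-assoc h (ℕ→ℚ 2) 1ℚ ⟩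
      h ℚ.+ ℕ→ℚ 3                    ≤⟨ ℚ.+-monoʳ-≤ h 3≤n*gap ⟩
      h ℚ.+ ℕ→ℚ n ℚ.* gap            ≡⟨ ℚ.+-comm h (ℕ→ℚ n ℚ.* gap) ⟩
      ℕ→ℚ n ℚ.* gap ℚ.+ h            ≡⟨ ℚ.*-distribˡ-+ (ℕ→ℚ n) gap (½ ℚ.* hi) ⟨
      ℕ→ℚ n ℚ.* (gap ℚ.+ ½ ℚ.* hi)   ≤⟨ *-monoˡ-≤-ℕ→ℚ n gap+½hi≤lo ⟩
      ℕ→ℚ n ℚ.* lo                   ≤⟨ proj₂ (proj₂ rounded) ⟩
      ℕ→ℚ (suc e)                    ≡⟨ trans (ℕ→ℚ-homo-+ 1 e) (ℚ.+-comm 1ℚ (ℕ→ℚ e)) ⟩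
      ℕ→ℚ e ℚ.+ 1ℚ                   ∎
      where
      h : ℚ
      h = ℕ→ℚ n ℚ.* (½ ℚ.* hi)

    open Construction m k e 2≤k 1≤m e≤m

    degree-≤ : ∀ v i → threshold ≤ i →
      ℕ→ℚ n ℚ.* (+ k / suc k ℚ.+ ½ ℚ.* approx μ i) ℚ.≤ ℕ→ℚ (degree G v)
    degree-≤ v i threshold≤i = begin
      ℕ→ℚ n ℚ.* (+ k / suc k ℚ.+ ½ ℚ.* approx μ i)
        ≤⟨ *-monoˡ-≤-ℕ→ℚ n (ℚ.+-monoʳ-≤ (+ k / suc k) (ℚ.*-monoˡ-≤-nonNeg ½ (≤hi i threshold≤i))) ⟩
      ℕ→ℚ n ℚ.* (+ k / suc k ℚ.+ ½ ℚ.* hi)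
        ≡⟨ trans (ℚ.*-distribˡ-+ (ℕ→ℚ n) (+ k / suc k) (½ ℚ.* hi)) (cong (ℚ._+ h) (ℕ→ℚ-*-/ m k k)) ⟩
      ℕ→ℚ (m * k) ℚ.+ h
        -- The 2 lost in `degree-bound` is offset by the 2 held in reserve in `n*½hi+2≤e`.
        ≤⟨ +-cancelʳ-≤ (ℕ→ℚ 2) (begin
             ℕ→ℚ (m * k) ℚ.+ h ℚ.+ ℕ→ℚ 2     ≡⟨ ℚ.+-assoc (ℕ→ℚ (m * k)) h (ℕ→ℚ 2) ⟩
             ℕ→ℚ (m * k) ℚ.+ (h ℚ.+ ℕ→ℚ 2)   ≤⟨ ℚ.+-monoʳ-≤ (ℕ→ℚ (m * k)) n*½hi+2≤e ⟩
             ℕ→ℚ (m * k) ℚ.+ ℕ→ℚ e           ≡⟨ ℕ→ℚ-homo-+ (m * k) e ⟨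
             ℕ→ℚ (m * k + e)                 ≤⟨ ℕ→ℚ-mono-≤ (degree-bound v) ⟩
             ℕ→ℚ (degree G v + 2)            ≡⟨ ℕ→ℚ-homo-+ (degree G v) 2 ⟩
             ℕ→ℚ (degree G v) ℚ.+ ℕ→ℚ 2      ∎) ⟩
      ℕ→ℚ (degree G v) ∎
      where
      h : ℚ
      h = ℕ→ℚ n ℚ.* (½ ℚ.* hi)

    bounded-≤ : ∀ v u i → threshold ≤ i →
      ℕ→ℚ (count (IncompatibilitySystem.incompatible? F v u)) ℚ.≤ ℕ→ℚ n ℚ.* approx μ i
    bounded-≤ v u i threshold≤i = begin
      ℕ→ℚ (count (IncompatibilitySystem.incompatible? F v u)) ≤⟨ ℕ→ℚ-mono-≤ (incompatible-count v u) ⟩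
      ℕ→ℚ e                   ≤⟨ e≤n*lo ⟩
      ℕ→ℚ n ℚ.* lo            ≤⟨ *-monoˡ-≤-ℕ→ℚ n (lo≤ i threshold≤i) ⟩
      ℕ→ℚ n ℚ.* approx μ i    ∎

    system : Σ (BoundedIncompatibilitySystem n (fromℚ (+ k / suc k) +ᴿ ½ · μ) μ) λ S →
             ¬ ContainsCompatibleHamiltonPower k (BoundedIncompatibilitySystem.F S)
    system = record
      { G = G
      ; F = F
      ; minDegree = λ v ε 0<ε → threshold , λ i threshold≤i → ≤⇒≤+ε (degree-≤ v i threshold≤i) 0<ε
      ; bounded = λ v u _ ε 0<ε → threshold , λ i threshold≤i → ≤⇒≤+ε (bounded-≤ v u i threshold≤i) 0<ε
      } , no-compatible-power
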